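{- Let $\varphi_7:\mathbb{N}\to\mathbb{N}$ be the function defined as follows. The values $\varphi_7(0),\varphi_7(1),\dots,\varphi_7(29)$ are, in order, $$9,8,7,5,6,3,4,2,1,0,\ 17,16,19,18,21,20,11,10,13,12,\ 15,14,25,24,23,22,29,28,27,26,$$ and for $x\ge 30$, $\varphi_7(x)=x\oplus_2 5$. Then, for all nonnegative integers $a,b$, the Halve Nim position $a^1b^17^1$ is a $\mathcal{P}$-position if and only if $b=\varphi_7(a)$. Furthermore, for $a,b\ge 30$, $a^1b^17^1$ is a $\mathcal{P}$-position if and only if $(a+2)\oplus(b+2)=5$.
   Context: $\mathbb{N}$ is the set of nonnegative integers and $\oplus$ denotes bitwise XOR. The $n$-shifted bitwise sum is $x\oplus_n y=\bigl((x+n)\oplus y\bigr)-n$. Halve Nim is a two-player game played on finitely many piles of coins; players alternate moves and a player who cannot move loses. A move is one of: (i) choose one pile and remove at least one coin from it; (ii) halve the game: simultaneously replace every pile of $m$ coins by a pile of $\lfloor m/2\rfloor$ coins. When there are no coins left, no move is available (halving requires at least one coin to be present). A position is a $\mathcal{P}$-position if the player who is not about to move has a winning strategy (equivalently, every move from it leads to an $\mathcal{N}$-position), and an $\mathcal{N}$-position if the player about to move has a winning strategy. $a^1b^1c^1$ denotes the position with three piles of sizes $a$, $b$, $c$ (a pile of size $0$ is an empty pile); in particular $a^1b^17^1$ has piles of sizes $a$, $b$, $7$. -}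

module Defs where

open import Data.Fin.Base using (fromℕ<)
open import Data.List.Base using (List; _∷_; map)
open import Data.List.Relation.Unary.Any using (Any)
open import Data.Nat.Base
open import Data.Nat.DivMod using (_%_)
open import Data.Nat.Properties
open import Data.Vec.Base using (Vec; []; _∷_; lookup)
open import Relation.Binary.PropositionalEquality using (_≡_; refl; cong)
open import Relation.Nullary.Decidable using (yes; no)

-- The XOR of the k lowest binary digits of m and n.

xorBits : ℕ → ℕ → ℕ → ℕ
xorBits zero    m n = 0
xorBits (suc k) m n = (m % 2 + n % 2) % 2 + 2 * xorBits k ⌊ m /2⌋ ⌊ n /2⌋

-- Neither m nor n has more than m + n binary digits, so no digit is lost;
-- ⊕-step below confirms that the bound plays no role.

infixl 6 _⊕_

_⊕_ : ℕ → ℕ → ℕ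
m ⊕ n = xorBits (m + n) m n

private
  ⌊/2⌋-bound : ∀ {m k} → m ≤ suc k → ⌊ m /2⌋ ≤ k
  ⌊/2⌋-bound {zero}  _         = z≤n
  ⌊/2⌋-bound {suc m} (s≤s m≤k) = ≤-trans (≤-pred (⌊n/2⌋<n m)) m≤k

  xorBits-0-0 : ∀ k → xorBits k 0 0 ≡ 0
  xorBits-0-0 zero    = refl
  xorBits-0-0 (suc k) rewrite xorBits-0-0 k = refl

xorBits-stable : ∀ k l {m n} → m ≤ k → n ≤ k → m ≤ l → n ≤ l →
                 xorBits k m n ≡ xorBits l m n
xorBits-stable zero    l       z≤n z≤n _   _   rewrite xorBits-0-0 l = refl
xorBits-stable (suc k) zero    _   _   z≤n z≤n = xorBits-0-0 (suc k)
xorBits-stable (suc k) (suc l) {m} {n} p q r s =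
  cong (λ t → (m % 2 + n % 2) % 2 + 2 * t)
    (xorBits-stable k l (⌊/2⌋-bound p) (⌊/2⌋-bound q)
                        (⌊/2⌋-bound r) (⌊/2⌋-bound s))

private
  step : ∀ m n k → m + n ≡ suc k →
         m ⊕ n ≡ (m % 2 + n % 2) % 2 + 2 * (⌊ m /2⌋ ⊕ ⌊ n /2⌋)
  step m n k eq rewrite eq =
    cong (λ t → (m % 2 + n % 2) % 2 + 2 * t)
      (xorBits-stable k (⌊ m /2⌋ + ⌊ n /2⌋)
        (⌊/2⌋-bound (≤-trans (m≤m+n m n) (≤-reflexive eq)))
        (⌊/2⌋-bound (≤-trans (m≤n+m n m) (≤-reflexive eq)))
        (m≤m+n _ _) (m≤n+m _ _))

⊕-step : ∀ m n → m ⊕ n ≡ (m % 2 + n % 2) % 2 + 2 * (⌊ m /2⌋ ⊕ ⌊ n /2⌋)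
⊕-step zero    zero    = refl
⊕-step zero    (suc n) = step zero (suc n) n refl
⊕-step (suc m) n       = step (suc m) n (m + n) refl

-- The n-shifted bitwise sum of x and y.  The subtraction is truncated, so this
-- has its intended meaning only when n ≤ (x + n) ⊕ y.

_⊕[_]_ : ℕ → ℕ → ℕ → ℕ
x ⊕[ n ] y = ((x + n) ⊕ y) ∸ n

φ₇-initial : Vec ℕ 30
φ₇-initial =
   9 ∷  8 ∷  7 ∷  5 ∷  6 ∷  3 ∷  4 ∷  2 ∷  1 ∷  0 ∷
  17 ∷ 16 ∷ 19 ∷ 18 ∷ 21 ∷ 20 ∷ 11 ∷ 10 ∷ 13 ∷ 12 ∷
  15 ∷ 14 ∷ 25 ∷ 24 ∷ 23 ∷ 22 ∷ 29 ∷ 28 ∷ 27 ∷ 26 ∷ []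

-- For x ≥ 30 the subtraction in x ⊕[ 2 ] 5 is exact: x + 2 ≥ 32 and XOR with 5
-- changes only the three lowest digits.

φ₇ : ℕ → ℕ
φ₇ x with x <? 30
... | yes x<30 = lookup φ₇-initial (fromℕ< x<30)
... | no  _    = x ⊕[ 2 ] 5

-- The sizes of the piles; empty piles are allowed.

Position : Set
Position = List ℕ

data _⟶ᵖ_ : Position → Position → Set where
  here  : ∀ {m m′ ps}   → m′ < m    → (m ∷ ps) ⟶ᵖ (m′ ∷ ps)
  there : ∀ {m ps ps′} → ps ⟶ᵖ ps′ → (m ∷ ps) ⟶ᵖ (m ∷ ps′)

data _⟶_ : Position → Position → Set where
  remove : ∀ {ps ps′} → ps ⟶ᵖ ps′      → ps ⟶ ps′
  halve  : ∀ {ps}     → Any (0 <_) ps → ps ⟶ map ⌊_/2⌋ ps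

-- An element of IsN p (respectively IsP p) is a winning strategy from p for the
-- player who is (respectively is not) about to move.

mutual
  data IsP (p : Position) : Set where
    isP : (∀ {q} → p ⟶ q → IsN q) → IsP p

  data IsN (p : Position) : Set where
    isN : ∀ {q} → p ⟶ q → IsP q → IsN p

{-# OPTIONS --safe #-}
module Submission where

-- The P-positions (a , b , c) with c ≤ 7 are the graphs b = Φ c a of eight
-- involutions, which are given by a table for a < 30 and are regular from there
-- on: the parity of Φ c a is that of a + c, and ⌊ Φ c a /2⌋ = ψ ⌊ c /2⌋ ⌊ a /2⌋ with
--   ψ 0 u , ψ 1 u = u ⊕ 1 , u  or  u , u ⊕ 1,
--   ψ 2 u = u ⊕[ 1 ] 1,
--   ψ 3 u = u ⊕[ 1 ] 2.
-- Halving interferes only with the choice between ψ 0 and ψ 1, which is exchanged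
-- each time u passes a number 7 · 2ᵏ.  What makes the graphs the P-positions is
-- checked by computation for a < 60, so that the regular description applies
-- to ⌊ a /2⌋ in the remaining cases.

open import Defs
open import Data.Bool.Base using (false; if_then_else_)
open import Data.List.Base using (List; []; _∷_; map)
open import Data.List.Relation.Unary.Any using (Any; here; there)
open import Data.Nat.Base
open import Data.Nat.DivMod using (_/_; _%_; m/n/o≡m/[n*o]; m/n≡1+[m∸n]/n; /-mono-≤)
open import Data.Nat.Induction using (<-wellFounded)
open import Data.Nat.ListAction using (sum)
open import Data.Nat.Logarithm using (⌊log₂_⌋; ⌊log₂⌋-mono-≤; ⌊log₂⌊n/2⌋⌋≡⌊log₂n⌋∸1)
open import Data.Nat.Properties
open import Data.Parity.Base using (Parity; 0ℙ; 1ℙ; _⁻¹) renaming (_+_ to _+ℙ_)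
import Data.Parity.Properties as ℙ
open import Data.Product.Base using (_×_; _,_; ∃; proj₁; proj₂)
open import Data.Sum.Base using (_⊎_; inj₁; inj₂; [_,_]′)
open import Data.Vec.Base using (toList)
open import Function.Base using (_∘_)
open import Function.Bundles using (_⇔_; mk⇔; Equivalence)
open import Induction.WellFounded using (Acc; acc)
open import Relation.Binary.Definitions using (tri<; tri≈; tri>)
open import Relation.Binary.PropositionalEquality
open import Relation.Nullary using (¬_; yes; no; contradiction)
open import Relation.Nullary.Decidable using (from-yes; _→-dec_; _⊎-dec_; ¬?)

-- Numbers as a last binary digit and a half

parity-suc : ∀ n → parity (suc n) ≡ parity n ⁻¹
parity-suc n = sym (ℙ.suc-homo-⁻¹ (suc n))

-- The number with half `n` and last digit `p`. The recursion is on `n`, so `bit p (suc n)` reduces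
-- while `p` is still a variable.
bit : Parity → ℕ → ℕ
bit p  (suc n) = suc (suc (bit p n))
bit 0ℙ zero    = 0
bit 1ℙ zero    = 1

⌊bit/2⌋ : ∀ p n → ⌊ bit p n /2⌋ ≡ n
⌊bit/2⌋ 0ℙ zero    = refl
⌊bit/2⌋ 1ℙ zero    = refl
⌊bit/2⌋ p  (suc n) = cong suc (⌊bit/2⌋ p n)

parity-bit : ∀ p n → parity (bit p n) ≡ p
parity-bit 0ℙ zero    = refl
parity-bit 1ℙ zero    = refl
parity-bit p  (suc n) = parity-bit p n

bit-η : ∀ n → bit (parity n) ⌊ n /2⌋ ≡ n
bit-η 0             = refl
bit-η 1             = refl
bit-η (suc (suc n)) = cong (suc ∘ suc) (bit-η n)

bit-ext : ∀ {m n} → parity m ≡ parity n → ⌊ m /2⌋ ≡ ⌊ n /2⌋ → m ≡ n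
bit-ext {m} {n} p h = trans (sym (bit-η m)) (trans (cong₂ bit p h) (bit-η n))

bit-mono-< : ∀ p q {m n} → m < n → bit p m < bit q n
bit-mono-< 0ℙ q {zero}  {suc n} m<n       = s≤s z≤n
bit-mono-< 1ℙ q {zero}  {suc n} m<n       = s≤s (s≤s z≤n)
bit-mono-< p  q {suc m} {suc n} (s≤s m<n) = s≤s (s≤s (bit-mono-< p q m<n))

/2-mono-<-parity : ∀ {m n} → m < n → ⌊ m /2⌋ ≡ ⌊ n /2⌋ → parity m ≡ 0ℙ × parity n ≡ 1ℙ
/2-mono-<-parity {0}           {1}           _               _  = refl , refl
/2-mono-<-parity {1}           {1}           (s≤s ())        _
/2-mono-<-parity {suc (suc m)} {suc (suc n)} (s≤s (s≤s m<n)) eq =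
  /2-mono-<-parity m<n (suc-injective eq)

-- XOR with 1 and with 2 as structural recursions

-- This is `n ⊕ 1`; see `⊕1≡swap`.
swap : ℕ → ℕ
swap 0             = 1
swap 1             = 0
swap (suc (suc n)) = suc (suc (swap n))

swap-involutive : ∀ n → swap (swap n) ≡ n
swap-involutive 0             = refl
swap-involutive 1             = refl
swap-involutive (suc (suc n)) = cong (suc ∘ suc) (swap-involutive n)

swap-≢ : ∀ n → swap n ≢ n
swap-≢ (suc (suc n)) eq = swap-≢ n (suc-injective (suc-injective eq))

⌊swap/2⌋ : ∀ n → ⌊ swap n /2⌋ ≡ ⌊ n /2⌋
⌊swap/2⌋ 0             = refl
⌊swap/2⌋ 1             = refl
⌊swap/2⌋ (suc (suc n)) = cong suc (⌊swap/2⌋ n)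

parity-swap : ∀ n → parity (swap n) ≡ parity n ⁻¹
parity-swap 0             = refl
parity-swap 1             = refl
parity-swap (suc (suc n)) = parity-swap n

swap-lower : ∀ n → n ≤ suc (swap n)
swap-lower 0             = z≤n
swap-lower 1             = s≤s z≤n
swap-lower (suc (suc n)) = s≤s (s≤s (swap-lower n))

swap-upper : ∀ n → swap n ≤ suc n
swap-upper 0             = s≤s z≤n
swap-upper 1             = z≤n
swap-upper (suc (suc n)) = s≤s (s≤s (swap-upper n))

swap-between : ∀ {m n} → m ≤ n → n < swap m → m ≡ n
swap-between {m} m≤n n<swap = ≤-antisym m≤n (s≤s⁻¹ (≤-trans n<swap (swap-upper m)))

-- One side is `n` and the other `n + 2`; the parity of `n` decides which.
swap-suc-≢ : ∀ n → swap (suc n) ≢ suc (swap n)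
swap-suc-≢ 0             ()
swap-suc-≢ 1             ()
swap-suc-≢ (suc (suc n)) eq = swap-suc-≢ n (suc-injective (suc-injective eq))

-- This is `n ⊕ 2`; see `⊕2≡swap₂`.
swap₂ : ℕ → ℕ
swap₂ 0                         = 2
swap₂ 1                         = 3
swap₂ 2                         = 0
swap₂ 3                         = 1
swap₂ (suc (suc (suc (suc n)))) = 4 + swap₂ n

swap₂-involutive : ∀ n → swap₂ (swap₂ n) ≡ n
swap₂-involutive 0                         = refl
swap₂-involutive 1                         = refl
swap₂-involutive 2                         = refl
swap₂-involutive 3                         = refl
swap₂-involutive (suc (suc (suc (suc n)))) = cong (4 +_) (swap₂-involutive n)

swap₂-≢ : ∀ n → swap₂ n ≢ n
swap₂-≢ (suc (suc (suc (suc n)))) eq = swap₂-≢ n (+-cancelˡ-≡ 4 _ _ eq)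

parity-swap₂ : ∀ n → parity (swap₂ n) ≡ parity n
parity-swap₂ 0                         = refl
parity-swap₂ 1                         = refl
parity-swap₂ 2                         = refl
parity-swap₂ 3                         = refl
parity-swap₂ (suc (suc (suc (suc n)))) = parity-swap₂ n

swap₂-lower : ∀ n → n ≤ 2 + swap₂ n
swap₂-lower 0                         = z≤n
swap₂-lower 1                         = s≤s z≤n
swap₂-lower 2                         = ≤-refl
swap₂-lower 3                         = ≤-refl
swap₂-lower (suc (suc (suc (suc n)))) = +-monoʳ-≤ 4 (swap₂-lower n)

-- As `swap₂` preserves blocks of four, the hypotheses force `m` and `n` into the same block, and
-- there into its lower half, which is a pair exchanged by `swap`.
swap₂-local : ∀ m n → m < swap₂ n → n < swap₂ m → m ≡ n ⊎ m ≡ swap n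
swap₂-local 0 0 _ _ = inj₁ refl
swap₂-local 0 1 _ _ = inj₂ refl
swap₂-local 1 0 _ _ = inj₂ refl
swap₂-local 1 1 _ _ = inj₁ refl
swap₂-local 0 2 () _
swap₂-local 1 2 () _
swap₂-local 2 n _ ()
swap₂-local 3 0 (s≤s (s≤s ())) _
swap₂-local 3 1 (s≤s (s≤s (s≤s ()))) _
swap₂-local 3 2 () _
swap₂-local 3 3 (s≤s ()) _
swap₂-local 0 3 _ (s≤s (s≤s ()))
swap₂-local 1 3 (s≤s ()) _
swap₂-local 0 (suc (suc (suc (suc n)))) _ (s≤s (s≤s ()))
swap₂-local 1 (suc (suc (suc (suc n)))) _ (s≤s (s≤s (s≤s ())))
swap₂-local 3 (suc (suc (suc (suc n)))) _ (s≤s ())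
swap₂-local (suc (suc (suc (suc m)))) 0 (s≤s (s≤s ())) _
swap₂-local (suc (suc (suc (suc m)))) 1 (s≤s (s≤s (s≤s ()))) _
swap₂-local (suc (suc (suc (suc m)))) 2 () _
swap₂-local (suc (suc (suc (suc m)))) 3 (s≤s ()) _
swap₂-local (suc (suc (suc (suc m)))) (suc (suc (suc (suc n)))) p q
  with swap₂-local m n (+-cancelˡ-< 4 _ _ p) (+-cancelˡ-< 4 _ _ q)
... | inj₁ eq = inj₁ (cong (4 +_) eq)
... | inj₂ eq = inj₂ (cong (4 +_) eq)

-- The eight involutions

swapIf : Parity → ℕ → ℕ
swapIf 0ℙ n = n
swapIf 1ℙ n = swap n

-- For n ≥ 7 the parity of the k with 7 · 2ᵏ ≤ n < 7 · 2ᵏ⁺¹.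
phase : ℕ → Parity
phase n = parity ⌊log₂ n / 7 ⌋

-- Halving commutes with division by 7, so it lowers the logarithm of `n / 7` by one and flips its
-- parity.
phase-/2 : ∀ {n} → 28 ≤ n → phase n ≡ phase ⌊ n /2⌋ ⁻¹
phase-/2 {n} 28≤n = begin
  parity l                              ≡⟨ cong parity (sym (m+[n∸m]≡n 1≤l)) ⟩
  parity (suc (l ∸ 1))                  ≡⟨ parity-suc (l ∸ 1) ⟩
  parity (l ∸ 1) ⁻¹                     ≡⟨ cong (λ t → parity t ⁻¹) (⌊log₂⌊n/2⌋⌋≡⌊log₂n⌋∸1 (n / 7)) ⟨
  parity ⌊log₂ ⌊ n / 7 /2⌋ ⌋ ⁻¹         ≡⟨ cong (λ t → parity ⌊log₂ t ⌋ ⁻¹) /-swap ⟩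
  parity ⌊log₂ ⌊ n /2⌋ / 7 ⌋ ⁻¹         ∎
  where
  open ≡-Reasoning
  l = ⌊log₂ n / 7 ⌋

  1≤l : 1 ≤ l
  1≤l = ≤-trans (s≤s z≤n) (⌊log₂⌋-mono-≤ {4} (/-mono-≤ 28≤n ≤-refl))

  ⌊/2⌋≡/2 : ∀ m → ⌊ m /2⌋ ≡ m / 2
  ⌊/2⌋≡/2 0             = refl
  ⌊/2⌋≡/2 1             = refl
  ⌊/2⌋≡/2 (suc (suc m)) =
    trans (cong suc (⌊/2⌋≡/2 m)) (sym (m/n≡1+[m∸n]/n {suc (suc m)} (s≤s (s≤s z≤n))))

  /-swap : ⌊ n / 7 /2⌋ ≡ ⌊ n /2⌋ / 7
  /-swap rewrite ⌊/2⌋≡/2 (n / 7) | ⌊/2⌋≡/2 n = trans (m/n/o≡m/[n*o] n 7 2) (sym (m/n/o≡m/[n*o] n 2 7))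

-- The 3 comes from `u + 1 = 4 + (u ∸ 3)` for `u ≥ 3`: XOR with 1 or 2 acts inside blocks of four,
-- so `u ⊕[ 1 ] 1` is `3 + swap (u ∸ 3)`, and likewise with 2 and `swap₂`.
ψ : ℕ → ℕ → ℕ
ψ 0 u = swapIf (phase u) u
ψ 1 u = swapIf (phase u ⁻¹) u
ψ 2 u = 3 + swap (u ∸ 3)
ψ _ u = 3 + swap₂ (u ∸ 3)

-- Rows 0 and 1 pair 28 and 29 with 30 and 31, whose partners are given by the formula in `Φ`; the
-- other rows permute the numbers below 30.
table : ℕ → List ℕ
table 0 =
   0 ∷ 2 ∷ 1 ∷ 3 ∷ 4 ∷ 5 ∷ 8 ∷ 9 ∷ 6 ∷ 7 ∷ 12 ∷ 13 ∷ 10 ∷ 11 ∷ 14 ∷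
  15 ∷ 16 ∷ 17 ∷ 18 ∷ 19 ∷ 20 ∷ 21 ∷ 22 ∷ 23 ∷ 24 ∷ 25 ∷ 26 ∷ 27 ∷ 30 ∷ 31 ∷ []
table 1 =
   2 ∷ 3 ∷ 0 ∷ 1 ∷ 5 ∷ 4 ∷ 9 ∷ 8 ∷ 7 ∷ 6 ∷ 13 ∷ 12 ∷ 11 ∷ 10 ∷ 15 ∷
  14 ∷ 17 ∷ 16 ∷ 19 ∷ 18 ∷ 21 ∷ 20 ∷ 23 ∷ 22 ∷ 25 ∷ 24 ∷ 27 ∷ 26 ∷ 31 ∷ 30 ∷ []
table 2 =
   1 ∷ 0 ∷ 2 ∷ 4 ∷ 3 ∷ 6 ∷ 5 ∷ 7 ∷ 8 ∷ 9 ∷ 10 ∷ 11 ∷ 12 ∷ 13 ∷ 18 ∷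
  19 ∷ 20 ∷ 21 ∷ 14 ∷ 15 ∷ 16 ∷ 17 ∷ 26 ∷ 27 ∷ 28 ∷ 29 ∷ 22 ∷ 23 ∷ 24 ∷ 25 ∷ []
table 3 =
   3 ∷ 1 ∷ 4 ∷ 0 ∷ 2 ∷ 7 ∷ 6 ∷ 5 ∷ 9 ∷ 8 ∷ 11 ∷ 10 ∷ 13 ∷ 12 ∷ 19 ∷
  18 ∷ 21 ∷ 20 ∷ 15 ∷ 14 ∷ 17 ∷ 16 ∷ 27 ∷ 26 ∷ 29 ∷ 28 ∷ 23 ∷ 22 ∷ 25 ∷ 24 ∷ []
table 4 =
   4 ∷ 5 ∷ 3 ∷ 2 ∷ 0 ∷ 1 ∷ 7 ∷ 6 ∷ 10 ∷ 11 ∷ 8 ∷ 9 ∷ 14 ∷ 15 ∷ 12 ∷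
  13 ∷ 18 ∷ 19 ∷ 16 ∷ 17 ∷ 22 ∷ 23 ∷ 20 ∷ 21 ∷ 26 ∷ 27 ∷ 24 ∷ 25 ∷ 28 ∷ 29 ∷ []
table 5 =
   5 ∷ 4 ∷ 6 ∷ 7 ∷ 1 ∷ 0 ∷ 2 ∷ 3 ∷ 11 ∷ 10 ∷ 9 ∷ 8 ∷ 15 ∷ 14 ∷ 13 ∷
  12 ∷ 19 ∷ 18 ∷ 17 ∷ 16 ∷ 23 ∷ 22 ∷ 21 ∷ 20 ∷ 27 ∷ 26 ∷ 25 ∷ 24 ∷ 29 ∷ 28 ∷ []
table 6 =
   8 ∷ 9 ∷ 5 ∷ 6 ∷ 7 ∷ 2 ∷ 3 ∷ 4 ∷ 0 ∷ 1 ∷ 16 ∷ 17 ∷ 18 ∷ 19 ∷ 20 ∷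
  21 ∷ 10 ∷ 11 ∷ 12 ∷ 13 ∷ 14 ∷ 15 ∷ 24 ∷ 25 ∷ 22 ∷ 23 ∷ 28 ∷ 29 ∷ 26 ∷ 27 ∷ []
table _ = toList φ₇-initial

at : List ℕ → ℕ → ℕ
at []       _       = 0
at (x ∷ _)  zero    = x
at (_ ∷ xs) (suc n) = at xs n

-- Meaningful for c ≤ 7 only.
Φ : ℕ → ℕ → ℕ
Φ c x = if x <ᵇ 30 then at (table c) x else bit (parity x +ℙ parity c) (ψ ⌊ c /2⌋ ⌊ x /2⌋)

-- Some graph is reached without touching only the first or only the second pile: by shortening the
-- third pile to `d`, or by halving.
ReachesP : ℕ → ℕ → ℕ → Set
ReachesP a b c = (∃ λ d → d < c × Φ d a ≡ b) ⊎ Φ ⌊ c /2⌋ ⌊ a /2⌋ ≡ ⌊ b /2⌋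

-- The finite checks

involutive-<60 : ∀ {c} → c < 8 → ∀ {a} → a < 60 → Φ c (Φ c a) ≡ a
involutive-<60 = from-yes
  (allUpTo? (λ c → allUpTo? (λ a → Φ c (Φ c a) ≟ a) 60) 8)

distinct-<60 : ∀ {c} → c < 8 → ∀ {d} → d < c → ∀ {a} → a < 60 → Φ d a ≢ Φ c a
distinct-<60 = from-yes
  (allUpTo? (λ c → allUpTo? (λ d → allUpTo? (λ a → ¬? (Φ d a ≟ Φ c a)) 60) c) 8)

-- The hypothesis `0 < c + a` excludes just the position without coins, which halving would map to
-- itself.
halve-<60 : ∀ {c} → c < 8 → ∀ {a} → a < 60 → 0 < c + a → Φ ⌊ c /2⌋ ⌊ a /2⌋ ≢ ⌊ Φ c a /2⌋
halve-<60 = from-yes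
  (allUpTo? (λ c → allUpTo? (λ a →
    (0 <? c + a) →-dec ¬? (Φ ⌊ c /2⌋ ⌊ a /2⌋ ≟ ⌊ Φ c a /2⌋)) 60) 8)

-- The bound `b < Φ c a` makes the search finite; the case `b < a` is left to `ReachesP-sym`.
reachesP-<60 : ∀ {c} → c < 8 → ∀ {a} → a < 60 → ∀ {b} → b < Φ c a → a ≤ b → a < Φ c b → ReachesP a b c
reachesP-<60 = from-yes
  (allUpTo? (λ c → allUpTo? (λ a → allUpTo? (λ b →
    (a ≤? b) →-dec ((a <? Φ c b) →-dec
      (anyUpTo? (λ d → Φ d a ≟ b) c ⊎-dec (Φ ⌊ c /2⌋ ⌊ a /2⌋ ≟ ⌊ b /2⌋)))) (Φ c a)) 60) 8)

-- The regular involutions on halves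

-- Both numbers have the same half, and from 28 on the phase is determined by that of the half.
phase-swap : ∀ {n} → 30 ≤ n → phase (swap n) ≡ phase n
phase-swap {n} 30≤n =
  trans (phase-/2 28≤swap)
    (trans (cong (λ t → phase t ⁻¹) (⌊swap/2⌋ n)) (sym (phase-/2 28≤n)))
  where
  28≤n : 28 ≤ n
  28≤n = ≤-trans (m≤n+m 28 2) 30≤n

  28≤swap : 28 ≤ swap n
  28≤swap = ≤-trans (n≤1+n 28) (s≤s⁻¹ (≤-trans 30≤n (swap-lower n)))

swapIf-involutive : ∀ p n → swapIf p (swapIf p n) ≡ n
swapIf-involutive 0ℙ n = refl
swapIf-involutive 1ℙ n = swap-involutive n

phase-swapIf : ∀ p {n} → 30 ≤ n → phase (swapIf p n) ≡ phase n
phase-swapIf 0ℙ _    = refl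
phase-swapIf 1ℙ 30≤n = phase-swap 30≤n

swapIf-lower : ∀ p n → n ≤ suc (swapIf p n)
swapIf-lower 0ℙ n = n≤1+n n
swapIf-lower 1ℙ n = swap-lower n

-- For `ψ 0` and `ψ 1` the second application makes the same choice as the first, since the phase
-- has not changed.
ψ-involutive : ∀ j {u} → 30 ≤ u → ψ j (ψ j u) ≡ u
ψ-involutive 0 {u} 30≤u rewrite phase-swapIf (phase u) 30≤u =
  swapIf-involutive (phase u) u
ψ-involutive 1 {u} 30≤u rewrite phase-swapIf (phase u ⁻¹) 30≤u =
  swapIf-involutive (phase u ⁻¹) u
ψ-involutive 2 (s≤s (s≤s (s≤s {n = n} _))) = cong (3 +_) (swap-involutive n)
ψ-involutive (suc (suc (suc _))) (s≤s (s≤s (s≤s {n = n} _))) = cong (3 +_) (swap₂-involutive n)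

ψ-lower : ∀ j {u} → 30 ≤ u → u ≤ 2 + ψ j u
ψ-lower 0 {u} _ = m≤n⇒m≤1+n (swapIf-lower (phase u) u)
ψ-lower 1 {u} _ = m≤n⇒m≤1+n (swapIf-lower (phase u ⁻¹) u)
ψ-lower 2 (s≤s (s≤s (s≤s {n = n} _))) = m≤n⇒m≤1+n (+-monoʳ-≤ 3 (swap-lower n))
ψ-lower (suc (suc (suc _))) (s≤s (s≤s (s≤s {n = n} _))) = +-monoʳ-≤ 3 (swap₂-lower n)

parity-≢ : ∀ {m n} → parity m ≡ parity n ⁻¹ → m ≢ n
parity-≢ {m} eq refl = ℙ.p≢p⁻¹ (parity m) eq

swapIf-⁻¹-≢ : ∀ p n → swapIf p n ≢ swapIf (p ⁻¹) n
swapIf-⁻¹-≢ 0ℙ n = ≢-sym (swap-≢ n)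
swapIf-⁻¹-≢ 1ℙ n = swap-≢ n

swapIf-≢-shifted-swap : ∀ p n → swapIf p (3 + n) ≢ 3 + swap n
swapIf-≢-shifted-swap 0ℙ n eq = swap-≢ n (sym (+-cancelˡ-≡ 3 _ _ eq))
-- The odd shift makes the two sides pair neighbours differently: after removing 2 they are
-- `swap (suc n)` and `suc (swap n)`.
swapIf-≢-shifted-swap 1ℙ n eq = swap-suc-≢ n (+-cancelˡ-≡ 2 _ _ eq)

swap-≢-swap₂ : ∀ n → swap n ≢ swap₂ n
swap-≢-swap₂ n =
  parity-≢ (trans (parity-swap n) (cong _⁻¹ (sym (parity-swap₂ n))))

parity-shifted-swap₂ : ∀ n → parity (3 + swap₂ n) ≡ parity (3 + n)
parity-shifted-swap₂ n =
  trans (parity-suc (swap₂ n)) (trans (cong _⁻¹ (parity-swap₂ n)) (sym (parity-suc n)))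

parity-shifted-swap : ∀ n → parity (3 + swap n) ≡ parity (3 + n) ⁻¹
parity-shifted-swap n =
  trans (parity-suc (swap n)) (cong _⁻¹ (trans (parity-swap n) (sym (parity-suc n))))

-- Without the swap, `swap₂` would have a fixed point; with it, the left side changes the parity and
-- the right side keeps it.
swapIf-≢-shifted-swap₂ : ∀ p n → swapIf p (3 + n) ≢ 3 + swap₂ n
swapIf-≢-shifted-swap₂ 0ℙ n eq = swap₂-≢ n (sym (+-cancelˡ-≡ 3 _ _ eq))
swapIf-≢-shifted-swap₂ 1ℙ n    = parity-≢
  (trans (parity-swap (3 + n)) (cong _⁻¹ (sym (parity-shifted-swap₂ n))))

ψ-distinct : ∀ {i j u} → i < j → j < 4 → 30 ≤ u → ψ i u ≢ ψ j u
ψ-distinct {0} {1} {u} _ _ _ = swapIf-⁻¹-≢ (phase u) u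
ψ-distinct {0} {2} {u} _ _ (s≤s (s≤s (s≤s {n = n} _))) = swapIf-≢-shifted-swap (phase u) n
ψ-distinct {0} {3} {u} _ _ (s≤s (s≤s (s≤s {n = n} _))) = swapIf-≢-shifted-swap₂ (phase u) n
ψ-distinct {1} {2} {u} _ _ (s≤s (s≤s (s≤s {n = n} _))) = swapIf-≢-shifted-swap (phase u ⁻¹) n
ψ-distinct {1} {3} {u} _ _ (s≤s (s≤s (s≤s {n = n} _))) = swapIf-≢-shifted-swap₂ (phase u ⁻¹) n
ψ-distinct {2} {3} {u} _ _ (s≤s (s≤s (s≤s {n = n} _))) eq =
  swap-≢-swap₂ n (+-cancelˡ-≡ 3 _ _ eq)
ψ-distinct {1} {1} (s≤s ()) _ _
ψ-distinct {2} {1} (s≤s ()) _ _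
ψ-distinct {2} {2} (s≤s (s≤s ())) _ _
ψ-distinct {suc (suc (suc _))} {1} (s≤s ()) _ _
ψ-distinct {suc (suc (suc _))} {2} (s≤s (s≤s ())) _ _
ψ-distinct {suc (suc (suc _))} {3} (s≤s (s≤s (s≤s ()))) _ _
ψ-distinct {j = suc (suc (suc (suc _)))} _ (s≤s (s≤s (s≤s (s≤s ())))) _

-- Of `ψ 0` and `ψ 1`, exactly the one selected by the phase leaves `u` alone. This provides a
-- target when the first two piles have equal halves.
fixed-by-ψ : ∀ u → ∃ λ i → i < 2 × ψ i u ≡ u
fixed-by-ψ u with phase u in eq
... | 0ℙ = 0 , s≤s z≤n , cong (λ p → swapIf p u) eq
... | 1ℙ = 1 , ≤-refl , cong (λ p → swapIf (p ⁻¹) u) eq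

-- The graphs for first piles from 60 on

≤⇒<ᵇ-false : ∀ {m n} → n ≤ m → (m <ᵇ n) ≡ false
≤⇒<ᵇ-false z≤n       = refl
≤⇒<ᵇ-false (s≤s n≤m) = ≤⇒<ᵇ-false n≤m

Φ-formula : ∀ c {x} → 30 ≤ x → Φ c x ≡ bit (parity x +ℙ parity c) (ψ ⌊ c /2⌋ ⌊ x /2⌋)
Φ-formula c {x} 30≤x =
  cong (λ t → if t then at (table c) x else bit (parity x +ℙ parity c) (ψ ⌊ c /2⌋ ⌊ x /2⌋))
    (≤⇒<ᵇ-false 30≤x)

parity-Φ : ∀ c {x} → 30 ≤ x → parity (Φ c x) ≡ parity x +ℙ parity c
parity-Φ c {x} 30≤x = trans (cong parity (Φ-formula c 30≤x)) (parity-bit _ (ψ ⌊ c /2⌋ ⌊ x /2⌋))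

⌊Φ/2⌋ : ∀ c {x} → 30 ≤ x → ⌊ Φ c x /2⌋ ≡ ψ ⌊ c /2⌋ ⌊ x /2⌋
⌊Φ/2⌋ c {x} 30≤x = trans (cong ⌊_/2⌋ (Φ-formula c 30≤x)) (⌊bit/2⌋ (parity x +ℙ parity c) (ψ ⌊ c /2⌋ ⌊ x /2⌋))

⌊/2⌋<⇒< : ∀ {m n} → ⌊ m /2⌋ < ⌊ n /2⌋ → m < n
⌊/2⌋<⇒< h = ≰⇒> λ n≤m → <⇒≱ h (⌊n/2⌋-mono n≤m)

60≤⇒30≤ : ∀ {x} → 60 ≤ x → 30 ≤ x
60≤⇒30≤ = ≤-trans (m≤m+n 30 30)

involutive-≥60 : ∀ c {a} → 60 ≤ a → Φ c (Φ c a) ≡ a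
involutive-≥60 c {a} 60≤a = bit-ext parities halves
  where
  j u : ℕ
  j = ⌊ c /2⌋
  u = ⌊ a /2⌋

  30≤a : 30 ≤ a
  30≤a = 60≤⇒30≤ 60≤a

  30≤u : 30 ≤ u
  30≤u = ⌊n/2⌋-mono 60≤a

  -- The half of `Φ c a` is at least 28 by `ψ-lower`, hence above 15, the half of 30: the formula
  -- applies to `Φ c a` again.
  30≤Φ : 30 ≤ Φ c a
  30≤Φ = <⇒≤ (⌊/2⌋<⇒< (subst (15 <_) (sym (⌊Φ/2⌋ c 30≤a))
    (+-cancelˡ-≤ 2 16 _ (≤-trans (m≤n+m 18 12) (≤-trans 30≤u (ψ-lower j 30≤u))))))

  parities : parity (Φ c (Φ c a)) ≡ parity a
  parities = begin
    parity (Φ c (Φ c a))              ≡⟨ parity-Φ c 30≤Φ ⟩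
    parity (Φ c a) +ℙ parity c        ≡⟨ cong (_+ℙ parity c) (parity-Φ c 30≤a) ⟩
    parity a +ℙ parity c +ℙ parity c  ≡⟨ +ℙ-cancelʳ (parity a) (parity c) ⟩
    parity a                          ∎
    where
    open ≡-Reasoning
    +ℙ-cancelʳ : ∀ p q → p +ℙ q +ℙ q ≡ p
    +ℙ-cancelʳ p q = trans (ℙ.+-assoc p q q) (trans (cong (p +ℙ_) (ℙ.p+p≡0ℙ q)) (ℙ.+-identityʳ p))

  halves : ⌊ Φ c (Φ c a) /2⌋ ≡ ⌊ a /2⌋
  halves = begin
    ⌊ Φ c (Φ c a) /2⌋  ≡⟨ ⌊Φ/2⌋ c 30≤Φ ⟩
    ψ j ⌊ Φ c a /2⌋    ≡⟨ cong (ψ j) (⌊Φ/2⌋ c 30≤a) ⟩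
    ψ j (ψ j u)        ≡⟨ ψ-involutive j 30≤u ⟩
    u                  ∎
    where open ≡-Reasoning

-- If `c` and `d` have equal halves, they differ in parity and so do the values; otherwise
-- `ψ-distinct` separates the halves of the values.
distinct-≥60 : ∀ {c} → c < 8 → ∀ {d} → d < c → ∀ {a} → 60 ≤ a → Φ d a ≢ Φ c a
distinct-≥60 {c} c<8 {d} d<c {a} 60≤a eq with ⌊ d /2⌋ ≟ ⌊ c /2⌋
... | yes h = <⇒≢ d<c (bit-ext (ℙ.+-cancelˡ-≡ (parity a) _ _
  (trans (sym (parity-Φ d (60≤⇒30≤ 60≤a))) (trans (cong parity eq) (parity-Φ c (60≤⇒30≤ 60≤a))))) h)
... | no  h = ψ-distinct (≤∧≢⇒< (⌊n/2⌋-mono (<⇒≤ d<c)) h) (s≤s (⌊n/2⌋-mono (s≤s⁻¹ c<8)))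
  (⌊n/2⌋-mono 60≤a)
  (trans (sym (⌊Φ/2⌋ d (60≤⇒30≤ 60≤a))) (trans (cong ⌊_/2⌋ eq) (⌊Φ/2⌋ c (60≤⇒30≤ 60≤a))))

phase-half : ∀ {u p} → 30 ≤ u → phase ⌊ u /2⌋ ≡ p → phase u ≡ p ⁻¹
phase-half 30≤u eq = trans (phase-/2 (≤-trans (m≤n+m 28 2) 30≤u)) (cong _⁻¹ eq)

-- Here the alternation of the phase is essential. Between `u` and its half exactly one is swapped:
-- if `u` is, the parities differ; if its half is, the halves differ. With both phases `0ℙ` the two
-- sides would both be `u`.
Φ-0-≢-ψ : ∀ p {u} → 30 ≤ u → phase ⌊ u /2⌋ ≡ p → Φ 0 u ≢ ψ 0 u
Φ-0-≢-ψ 0ℙ {u} 30≤u half eq = parity-≢ (begin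
  parity (swap u)    ≡⟨ parity-swap u ⟩
  parity u ⁻¹        ≡⟨ cong _⁻¹ (ℙ.+-identityʳ (parity u)) ⟨
  (parity u +ℙ 0ℙ) ⁻¹  ≡⟨ cong _⁻¹ (parity-Φ 0 30≤u) ⟨
  parity (Φ 0 u) ⁻¹  ∎)
  (sym (trans eq (cong (λ p → swapIf p u) (phase-half 30≤u half))))
  where open ≡-Reasoning
Φ-0-≢-ψ 1ℙ {u} 30≤u half eq = swap-≢ ⌊ u /2⌋ (begin
  swap ⌊ u /2⌋                    ≡⟨ cong (λ p → swapIf p ⌊ u /2⌋) half ⟨
  ψ 0 ⌊ u /2⌋                     ≡⟨ ⌊Φ/2⌋ 0 30≤u ⟨
  ⌊ Φ 0 u /2⌋                     ≡⟨ cong ⌊_/2⌋ eq ⟩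
  ⌊ ψ 0 u /2⌋                     ≡⟨ cong (λ p → ⌊ swapIf p u /2⌋) (phase-half 30≤u half) ⟩
  ⌊ u /2⌋                         ∎)
  where open ≡-Reasoning

Φ-1-≢-ψ : ∀ p {u} → 30 ≤ u → phase ⌊ u /2⌋ ≡ p → Φ 1 u ≢ ψ 1 u
Φ-1-≢-ψ 0ℙ {u} 30≤u half eq = parity-≢
  (trans (parity-Φ 1 30≤u) (ℙ.+-comm (parity u) 1ℙ))
  (trans eq (cong (λ p → swapIf (p ⁻¹) u) (phase-half 30≤u half)))
Φ-1-≢-ψ 1ℙ {u} 30≤u half eq = swap-≢ ⌊ u /2⌋ (begin
  swap ⌊ u /2⌋   ≡⟨ cong (λ p → swapIf p ⌊ u /2⌋) half ⟨
  ψ 0 ⌊ u /2⌋    ≡⟨ ⌊Φ/2⌋ 1 30≤u ⟨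
  ⌊ Φ 1 u /2⌋    ≡⟨ cong ⌊_/2⌋ eq ⟩
  ⌊ ψ 1 u /2⌋    ≡⟨ cong (λ p → ⌊ swapIf (p ⁻¹) u /2⌋) (phase-half 30≤u half) ⟩
  ⌊ swap u /2⌋   ≡⟨ ⌊swap/2⌋ u ⟩
  ⌊ u /2⌋        ∎)
  where open ≡-Reasoning

-- Halving a point of the graph of `Φ c` gives `ψ j u` as second pile, which must miss the graph of
-- `Φ j`. For `j = 2` and `j = 3` parity decides: `Φ 2` and `ψ 3` keep it, `ψ 2` and `Φ 3` change
-- it.
Φ-≢-ψ : ∀ {j u} → j < 4 → 30 ≤ u → Φ j u ≢ ψ j u
Φ-≢-ψ {0} {u} _ 30≤u = Φ-0-≢-ψ (phase ⌊ u /2⌋) 30≤u refl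
Φ-≢-ψ {1} {u} _ 30≤u = Φ-1-≢-ψ (phase ⌊ u /2⌋) 30≤u refl
Φ-≢-ψ {2} {u} _ 30≤u@(s≤s (s≤s (s≤s {n = n} _))) = ≢-sym (parity-≢ (trans (parity-shifted-swap n)
  (cong _⁻¹ (sym (trans (parity-Φ 2 30≤u) (ℙ.+-identityʳ (parity u)))))))
Φ-≢-ψ {3} {u} _ 30≤u@(s≤s (s≤s (s≤s {n = n} _))) = parity-≢
  (trans (parity-Φ 3 30≤u) (trans (ℙ.+-comm (parity u) 1ℙ) (cong _⁻¹ (sym (parity-shifted-swap₂ n)))))
Φ-≢-ψ {suc (suc (suc (suc _)))} (s≤s (s≤s (s≤s (s≤s ())))) _

halve-≥60 : ∀ {c} → c < 8 → ∀ {a} → 60 ≤ a → Φ ⌊ c /2⌋ ⌊ a /2⌋ ≢ ⌊ Φ c a /2⌋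
halve-≥60 {c} c<8 60≤a eq = Φ-≢-ψ (s≤s (⌊n/2⌋-mono (s≤s⁻¹ c<8))) (⌊n/2⌋-mono 60≤a)
  (trans eq (⌊Φ/2⌋ c (60≤⇒30≤ 60≤a)))

-- Where `ψ 0` swaps `u`, the phase of the half is `0ℙ`, so `Φ 0` swaps nothing. Halving thus
-- reaches the case that `ψ 0` leaves open.
Φ-0-fixes : ∀ {u} → 30 ≤ u → phase u ≡ 1ℙ → Φ 0 u ≡ u
Φ-0-fixes {u} 30≤u eq = bit-ext
  (trans (parity-Φ 0 30≤u) (ℙ.+-identityʳ (parity u)))
  (trans (⌊Φ/2⌋ 0 30≤u) (cong (λ p → swapIf p ⌊ u /2⌋) phase-half-0))
  where
  phase-half-0 : phase ⌊ u /2⌋ ≡ 0ℙ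
  phase-half-0 = ℙ.⁻¹-injective (trans (sym (phase-half 30≤u refl)) eq)

swapIf-between : ∀ p {u v} → u ≤ v → v < swapIf p u → p ≡ 1ℙ × u ≡ v
swapIf-between 0ℙ u≤v v<u    = contradiction u≤v (<⇒≱ v<u)
swapIf-between 1ℙ u≤v v<swap = refl , swap-between u≤v v<swap

-- The bounds leave `v ≡ u`, and for `j = 3` also `v ≡ swap₃` with XOR 1 taken after the shift by 3,
-- which is `ψ 2 u`. The value `u` is taken by `ψ 0` or `ψ 1`, at an index below `j` unless `j = 0`,
-- where halving serves instead.
ψ-reaches : ∀ {j u v} → j < 4 → 30 ≤ u → u ≤ v → v < ψ j u → u < ψ j v →
            (∃ λ i → i < j × ψ i u ≡ v) ⊎ Φ j u ≡ v
ψ-reaches {0} {u} _ 30≤u u≤v v<ψ _ with swapIf-between (phase u) u≤v v<ψ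
... | phase≡1 , refl = inj₂ (Φ-0-fixes 30≤u phase≡1)
ψ-reaches {1} {u} _ 30≤u u≤v v<ψ _ with swapIf-between (phase u ⁻¹) u≤v v<ψ
... | phase⁻¹≡1 , refl = inj₁ (0 , s≤s z≤n ,
  cong (λ p → swapIf p u) (ℙ.⁻¹-injective {phase u} {0ℙ} phase⁻¹≡1))
ψ-reaches {2} _ (s≤s (s≤s (s≤s {n = m} _))) (s≤s (s≤s (s≤s m≤n))) v<ψ _
  with fixed-by-ψ (3 + m)
... | i , i<2 , eq = inj₁ (i , i<2 ,
  trans eq (cong (3 +_) (swap-between m≤n (+-cancelˡ-< 3 _ _ v<ψ))))
ψ-reaches {3} _ (s≤s (s≤s (s≤s {n = m} _))) (s≤s (s≤s (s≤s {n = n} _))) v<ψ u<ψ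
  with swap₂-local n m (+-cancelˡ-< 3 _ _ v<ψ) (+-cancelˡ-< 3 _ _ u<ψ)
... | inj₂ eq = inj₁ (2 , ≤-refl , cong (3 +_) (sym eq))
... | inj₁ eq with fixed-by-ψ (3 + m)
...   | i , i<2 , eq′ = inj₁ (i , m≤n⇒m≤1+n i<2 , trans eq′ (cong (3 +_) (sym eq)))
ψ-reaches {suc (suc (suc (suc _)))} (s≤s (s≤s (s≤s (s≤s ())))) _

reachesP-≥60 : ∀ {c} → c < 8 → ∀ {a} → 60 ≤ a → ∀ {b} → b < Φ c a → a ≤ b → a < Φ c b → ReachesP a b c
reachesP-≥60 {c} c<8 {a} 60≤a {b} b<Φ a≤b a<Φ with ⌊ b /2⌋ ≟ ψ ⌊ c /2⌋ ⌊ a /2⌋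
-- Now `b` and `Φ c a` have the same half, as do `a` and `Φ c b`. The strict inequalities make `a`
-- and `b` even and `Φ c a` odd, so `c` is odd, and shortening the third pile by one coin works.
... | yes v≡ψ = inj₁ (bit 0ℙ j , bit<c , Φ≡b)
  where
  j u : ℕ
  j = ⌊ c /2⌋
  u = ⌊ a /2⌋

  30≤a : 30 ≤ a
  30≤a = 60≤⇒30≤ 60≤a

  30≤b : 30 ≤ b
  30≤b = ≤-trans 30≤a a≤b

  u≡ψ : u ≡ ψ j ⌊ b /2⌋
  u≡ψ = sym (trans (cong (ψ j) v≡ψ) (ψ-involutive j (⌊n/2⌋-mono 60≤a)))

  b-even×Φ-odd : parity b ≡ 0ℙ × parity (Φ c a) ≡ 1ℙ
  b-even×Φ-odd = /2-mono-<-parity b<Φ (trans v≡ψ (sym (⌊Φ/2⌋ c 30≤a)))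

  a-even : parity a ≡ 0ℙ
  a-even = proj₁ (/2-mono-<-parity a<Φ (trans u≡ψ (sym (⌊Φ/2⌋ c 30≤b))))

  c-odd : parity c ≡ 1ℙ
  c-odd = trans (sym (trans (parity-Φ c 30≤a) (cong (_+ℙ parity c) a-even))) (proj₂ b-even×Φ-odd)

  bit<c : bit 0ℙ j < c
  bit<c = subst (bit 0ℙ j <_) (trans (cong (λ p → bit p j) (sym c-odd)) (bit-η c)) (bit-0<bit-1 j)
    where
    bit-0<bit-1 : ∀ n → bit 0ℙ n < bit 1ℙ n
    bit-0<bit-1 zero    = s≤s z≤n
    bit-0<bit-1 (suc n) = s≤s (s≤s (bit-0<bit-1 n))

  Φ≡b : Φ (bit 0ℙ j) a ≡ b
  Φ≡b = bit-ext
    (trans (parity-Φ (bit 0ℙ j) 30≤a)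
      (trans (cong₂ _+ℙ_ a-even (parity-bit 0ℙ j)) (sym (proj₁ b-even×Φ-odd))))
    (trans (⌊Φ/2⌋ (bit 0ℙ j) 30≤a)
      (trans (cong (λ i → ψ i u) (⌊bit/2⌋ 0ℙ j)) (sym v≡ψ)))
-- Otherwise both inequalities stay strict after halving.
... | no v≢ψ
  with ψ-reaches (s≤s (⌊n/2⌋-mono (s≤s⁻¹ c<8))) (⌊n/2⌋-mono 60≤a) (⌊n/2⌋-mono a≤b)
    (≤∧≢⇒< (subst (⌊ b /2⌋ ≤_) (⌊Φ/2⌋ c 30≤a) (⌊n/2⌋-mono (<⇒≤ b<Φ))) v≢ψ)
    (≤∧≢⇒< (subst (⌊ a /2⌋ ≤_) (⌊Φ/2⌋ c 30≤b) (⌊n/2⌋-mono (<⇒≤ a<Φ))) u≢ψ)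
  where
  30≤a : 30 ≤ a
  30≤a = 60≤⇒30≤ 60≤a

  30≤b : 30 ≤ b
  30≤b = ≤-trans 30≤a a≤b

  u≢ψ : ⌊ a /2⌋ ≢ ψ ⌊ c /2⌋ ⌊ b /2⌋
  u≢ψ eq = v≢ψ (sym (trans (cong (ψ ⌊ c /2⌋) eq)
    (ψ-involutive ⌊ c /2⌋ (⌊n/2⌋-mono (≤-trans 60≤a a≤b)))))
...   | inj₂ eq = inj₂ eq
-- Both numbers with half `i` are below `c`; the digit `p` is the one that gives the value the
-- parity of `b`.
...   | inj₁ (i , i<j , eq) = inj₁ (bit p i , subst (bit p i <_) (bit-η c) (bit-mono-< p (parity c) i<j) , Φ≡b)
  where
  30≤a : 30 ≤ a
  30≤a = 60≤⇒30≤ 60≤a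

  p : Parity
  p = parity a +ℙ parity b

  Φ≡b : Φ (bit p i) a ≡ b
  Φ≡b = bit-ext
    (begin
      parity (Φ (bit p i) a)               ≡⟨ parity-Φ (bit p i) 30≤a ⟩
      parity a +ℙ parity (bit p i)         ≡⟨ cong (parity a +ℙ_) (parity-bit p i) ⟩
      parity a +ℙ (parity a +ℙ parity b)   ≡⟨ ℙ.+-assoc (parity a) (parity a) (parity b) ⟨
      parity a +ℙ parity a +ℙ parity b     ≡⟨ cong (_+ℙ parity b) (ℙ.p+p≡0ℙ (parity a)) ⟩
      parity b                             ∎)
    (trans (⌊Φ/2⌋ (bit p i) 30≤a) (trans (cong (λ i → ψ i ⌊ a /2⌋) (⌊bit/2⌋ p i)) eq))
    where open ≡-Reasoning

-- The graphs for all first piles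

involutive : ∀ {c} → c < 8 → ∀ a → Φ c (Φ c a) ≡ a
involutive {c} c<8 a with a <? 60
... | yes a<60 = involutive-<60 c<8 a<60
... | no  a≮60 = involutive-≥60 c (≮⇒≥ a≮60)

distinct : ∀ {c d} → c < 8 → d < c → ∀ a → Φ d a ≢ Φ c a
distinct c<8 d<c a with a <? 60
... | yes a<60 = distinct-<60 c<8 d<c a<60
... | no  a≮60 = distinct-≥60 c<8 d<c (≮⇒≥ a≮60)

halve-≢ : ∀ {c} → c < 8 → ∀ a → 0 < c + a → Φ ⌊ c /2⌋ ⌊ a /2⌋ ≢ ⌊ Φ c a /2⌋
halve-≢ c<8 a 0<c+a with a <? 60
... | yes a<60 = halve-<60 c<8 a<60 0<c+a
... | no  a≮60 = halve-≥60 c<8 (≮⇒≥ a≮60)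

involutive⇒sym : ∀ {c} → c < 8 → ∀ {a b} → Φ c a ≡ b → Φ c b ≡ a
involutive⇒sym {c} c<8 {a} eq = trans (cong (Φ c) (sym eq)) (involutive c<8 a)

ReachesP-sym : ∀ {c} → c < 8 → ∀ {a b} → ReachesP a b c → ReachesP b a c
ReachesP-sym c<8 (inj₁ (d , d<c , eq)) = inj₁ (d , d<c , involutive⇒sym (<-trans d<c c<8) eq)
ReachesP-sym {c} c<8 (inj₂ eq)         = inj₂ (involutive⇒sym (≤-<-trans (⌊n/2⌋≤n c) c<8) eq)

reachesP-ordered : ∀ {c} → c < 8 → ∀ {a b} → a ≤ b → b < Φ c a → a < Φ c b → ReachesP a b c
reachesP-ordered c<8 {a} a≤b b<Φ a<Φ with a <? 60
... | yes a<60 = reachesP-<60 c<8 a<60 b<Φ a≤b a<Φ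
... | no  a≮60 = reachesP-≥60 c<8 (≮⇒≥ a≮60) b<Φ a≤b a<Φ

reachesP : ∀ {c} → c < 8 → ∀ a b → b < Φ c a → a < Φ c b → ReachesP a b c
reachesP c<8 a b b<Φ a<Φ with ≤-total a b
... | inj₁ a≤b = reachesP-ordered c<8 a≤b b<Φ a<Φ
... | inj₂ b≤a = ReachesP-sym c<8 (reachesP-ordered c<8 b≤a a<Φ b<Φ)

-- Outcomes of the positions

⟶ᵖ-decreases-sum : ∀ {p q} → p ⟶ᵖ q → sum q < sum p
⟶ᵖ-decreases-sum (here {ps = ps} m′<m) = +-monoˡ-< (sum ps) m′<m
⟶ᵖ-decreases-sum (there {m = m} move)  = +-monoʳ-< m (⟶ᵖ-decreases-sum move)

sum-halve-≤ : ∀ p → sum (map ⌊_/2⌋ p) ≤ sum p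
sum-halve-≤ []      = z≤n
sum-halve-≤ (m ∷ p) = +-mono-≤ (⌊n/2⌋≤n m) (sum-halve-≤ p)

sum-halve-< : ∀ {p} → Any (0 <_) p → sum (map ⌊_/2⌋ p) < sum p
sum-halve-< {suc m ∷ p} (here _)  = +-mono-<-≤ (⌊n/2⌋<n m) (sum-halve-≤ p)
sum-halve-< {m ∷ p}     (there h) = +-mono-≤-< (⌊n/2⌋≤n m) (sum-halve-< h)

⟶-decreases-sum : ∀ {p q} → p ⟶ q → sum q < sum p
⟶-decreases-sum (remove move) = ⟶ᵖ-decreases-sum move
⟶-decreases-sum (halve h)     = sum-halve-< h

P-N-exclusive : ∀ {p} → IsP p → ¬ IsN p
P-N-exclusive (isP f) (isN move q) = P-N-exclusive q (f move)

nonempty⇒0<c+a : ∀ a c → Any (0 <_) (a ∷ Φ c a ∷ c ∷ []) → 0 < c + a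
nonempty⇒0<c+a zero    zero    (there (there (there ())))
nonempty⇒0<c+a zero    (suc c) _ = s≤s z≤n
nonempty⇒0<c+a (suc a) c       _ = m≤n⇒m≤o+n c (s≤s z≤n)

<Φ⇒nonempty : ∀ a b c → a < Φ c b → Any (0 <_) (a ∷ b ∷ c ∷ [])
<Φ⇒nonempty (suc a) b       c       _ = here (s≤s z≤n)
<Φ⇒nonempty zero    (suc b) c       _ = there (here (s≤s z≤n))
<Φ⇒nonempty zero    zero    (suc c) _ = there (there (here (s≤s z≤n)))

-- Induction on the number of coins. Off the graph, a pile exceeding the partner of the other one is
-- shortened to that partner; if both are below their partners, `reachesP` provides the move.
outcome : ∀ {a b c} → c < 8 → Acc _<_ (sum (a ∷ b ∷ c ∷ [])) →
          (Φ c a ≡ b → IsP (a ∷ b ∷ c ∷ [])) × (Φ c a ≢ b → IsN (a ∷ b ∷ c ∷ []))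
outcome {a} {b} {c} c<8 (acc smaller) = P , N
  where
  ⌊c/2⌋<8 : ⌊ c /2⌋ < 8
  ⌊c/2⌋<8 = ≤-<-trans (⌊n/2⌋≤n c) c<8

  toP : ∀ {a′ b′ c′} → c′ < 8 → (a ∷ b ∷ c ∷ []) ⟶ (a′ ∷ b′ ∷ c′ ∷ []) →
        Φ c′ a′ ≡ b′ → IsN (a ∷ b ∷ c ∷ [])
  toP c′<8 move eq = isN move (proj₁ (outcome c′<8 (smaller (⟶-decreases-sum move))) eq)

  toN : ∀ {a′ b′ c′} → c′ < 8 → (a ∷ b ∷ c ∷ []) ⟶ (a′ ∷ b′ ∷ c′ ∷ []) →
        Φ c′ a′ ≢ b′ → IsN (a′ ∷ b′ ∷ c′ ∷ [])
  toN c′<8 move = proj₂ (outcome c′<8 (smaller (⟶-decreases-sum move)))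

  P : Φ c a ≡ b → IsP (a ∷ b ∷ c ∷ [])
  P refl = isP λ where
    -- Two first piles with the same partner coincide, as `Φ c` is an involution.
    move@(remove (here a′<a)) → toN c<8 move λ eq →
      <⇒≢ a′<a (trans (sym (involutive⇒sym c<8 eq)) (involutive c<8 a))
    move@(remove (there (here b′<b))) → toN c<8 move λ eq → <⇒≢ b′<b (sym eq)
    move@(remove (there (there (here c′<c)))) →
      toN (<-trans c′<c c<8) move (distinct c<8 c′<c a)
    (remove (there (there (there ()))))
    move@(halve h) → toN ⌊c/2⌋<8 move (halve-≢ c<8 a (nonempty⇒0<c+a a c h))

  N : Φ c a ≢ b → IsN (a ∷ b ∷ c ∷ [])
  N Φ≢b with <-cmp b (Φ c a)
  ... | tri≈ _ b≡Φ _ = contradiction (sym b≡Φ) Φ≢b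
  ... | tri> _ _ Φ<b = toP c<8 (remove (there (here Φ<b))) refl
  ... | tri< b<Φ _ _ with <-cmp a (Φ c b)
  ...   | tri≈ _ a≡Φ _ = contradiction (involutive⇒sym c<8 (sym a≡Φ)) Φ≢b
  ...   | tri> _ _ Φ<a = toP c<8 (remove (here Φ<a)) (involutive c<8 b)
  ...   | tri< a<Φ _ _ with reachesP c<8 a b b<Φ a<Φ
  ...     | inj₁ (d , d<c , eq) = toP (<-trans d<c c<8) (remove (there (there (here d<c)))) eq
  ...     | inj₂ eq             = toP ⌊c/2⌋<8 (halve (<Φ⇒nonempty a b c a<Φ)) eq

IsP⇔Φ : ∀ {a b c} → c < 8 → IsP (a ∷ b ∷ c ∷ []) ⇔ Φ c a ≡ b
IsP⇔Φ {a} {b} {c} c<8 = mk⇔ to (proj₁ classified)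
  where
  classified : (Φ c a ≡ b → IsP (a ∷ b ∷ c ∷ [])) × (Φ c a ≢ b → IsN (a ∷ b ∷ c ∷ []))
  classified = outcome c<8 (<-wellFounded _)

  to : IsP (a ∷ b ∷ c ∷ []) → Φ c a ≡ b
  to p with Φ c a ≟ b
  ... | yes eq = eq
  ... | no  ne = contradiction (proj₂ classified ne) (P-N-exclusive p)

-- XOR digit by digit

2*≡bit : ∀ k → 2 * k ≡ bit 0ℙ k
2*≡bit zero    = refl
2*≡bit (suc k) = cong suc (trans (+-suc k (k + 0)) (cong suc (2*≡bit k)))

suc-bit-0 : ∀ k → suc (bit 0ℙ k) ≡ bit 1ℙ k
suc-bit-0 zero    = refl
suc-bit-0 (suc k) = cong (suc ∘ suc) (suc-bit-0 k)

%2-bit : ∀ m n k → (m % 2 + n % 2) % 2 + 2 * k ≡ bit (parity m +ℙ parity n) k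
%2-bit 0             0             k = 2*≡bit k
%2-bit 0             1             k = trans (cong suc (2*≡bit k)) (suc-bit-0 k)
%2-bit 1             0             k = trans (cong suc (2*≡bit k)) (suc-bit-0 k)
%2-bit 1             1             k = 2*≡bit k
%2-bit 0             (suc (suc n)) k = %2-bit 0 n k
%2-bit 1             (suc (suc n)) k = %2-bit 1 n k
%2-bit (suc (suc m)) n             k = %2-bit m n k

⊕-bit : ∀ m n → m ⊕ n ≡ bit (parity m +ℙ parity n) (⌊ m /2⌋ ⊕ ⌊ n /2⌋)
⊕-bit m n = trans (⊕-step m n) (%2-bit m n _)

parity-⊕ : ∀ m n → parity (m ⊕ n) ≡ parity m +ℙ parity n
parity-⊕ m n = trans (cong parity (⊕-bit m n)) (parity-bit _ (⌊ m /2⌋ ⊕ ⌊ n /2⌋))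

⌊⊕/2⌋ : ∀ m n → ⌊ m ⊕ n /2⌋ ≡ ⌊ m /2⌋ ⊕ ⌊ n /2⌋
⌊⊕/2⌋ m n = trans (cong ⌊_/2⌋ (⊕-bit m n)) (⌊bit/2⌋ (parity m +ℙ parity n) _)

⊕-identityˡ : ∀ n → 0 ⊕ n ≡ n
⊕-identityˡ n = go n (<-wellFounded n)
  where
  go : ∀ n → Acc _<_ n → 0 ⊕ n ≡ n
  go zero    _             = refl
  go (suc n) (acc smaller) = bit-ext (parity-⊕ 0 (suc n))
    (trans (⌊⊕/2⌋ 0 (suc n)) (go ⌊ suc n /2⌋ (smaller (⌊n/2⌋<n n))))

⊕-identityʳ : ∀ n → n ⊕ 0 ≡ n
⊕-identityʳ n = go n (<-wellFounded n)
  where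
  go : ∀ n → Acc _<_ n → n ⊕ 0 ≡ n
  go zero    _             = refl
  go (suc n) (acc smaller) = bit-ext
    (trans (parity-⊕ (suc n) 0) (ℙ.+-identityʳ (parity (suc n))))
    (trans (⌊⊕/2⌋ (suc n) 0) (go ⌊ suc n /2⌋ (smaller (⌊n/2⌋<n n))))

-- Digit by digit, equal parities cancel. This is what solves `(a + 2) ⊕ (b + 2) ≡ 5` for `b + 2`.
⊕-cancel : ∀ m n → m ⊕ (m ⊕ n) ≡ n
⊕-cancel m n = go m (<-wellFounded m) n
  where
  go : ∀ m → Acc _<_ m → ∀ n → m ⊕ (m ⊕ n) ≡ n
  go zero      _             n = trans (⊕-identityˡ (0 ⊕ n)) (⊕-identityˡ n)
  go m@(suc k) (acc smaller) n = bit-ext parities halves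
    where
    open ≡-Reasoning
    parities : parity (m ⊕ (m ⊕ n)) ≡ parity n
    parities = begin
      parity (m ⊕ (m ⊕ n))                ≡⟨ parity-⊕ m (m ⊕ n) ⟩
      parity m +ℙ parity (m ⊕ n)          ≡⟨ cong (parity m +ℙ_) (parity-⊕ m n) ⟩
      parity m +ℙ (parity m +ℙ parity n)  ≡⟨ ℙ.+-assoc (parity m) (parity m) (parity n) ⟨
      parity m +ℙ parity m +ℙ parity n    ≡⟨ cong (_+ℙ parity n) (ℙ.p+p≡0ℙ (parity m)) ⟩
      parity n                            ∎

    halves : ⌊ m ⊕ (m ⊕ n) /2⌋ ≡ ⌊ n /2⌋
    halves = begin
      ⌊ m ⊕ (m ⊕ n) /2⌋              ≡⟨ ⌊⊕/2⌋ m (m ⊕ n) ⟩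
      ⌊ m /2⌋ ⊕ ⌊ m ⊕ n /2⌋          ≡⟨ cong (⌊ m /2⌋ ⊕_) (⌊⊕/2⌋ m n) ⟩
      ⌊ m /2⌋ ⊕ (⌊ m /2⌋ ⊕ ⌊ n /2⌋)  ≡⟨ go ⌊ m /2⌋ (smaller (⌊n/2⌋<n k)) ⌊ n /2⌋ ⟩
      ⌊ n /2⌋                        ∎

⊕1≡swap : ∀ n → n ⊕ 1 ≡ swap n
⊕1≡swap n = bit-ext
  (trans (parity-⊕ n 1) (trans (ℙ.+-comm (parity n) 1ℙ) (sym (parity-swap n))))
  (trans (⌊⊕/2⌋ n 1) (trans (⊕-identityʳ ⌊ n /2⌋) (sym (⌊swap/2⌋ n))))

⌊swap₂/2⌋ : ∀ n → ⌊ swap₂ n /2⌋ ≡ swap ⌊ n /2⌋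
⌊swap₂/2⌋ 0                         = refl
⌊swap₂/2⌋ 1                         = refl
⌊swap₂/2⌋ 2                         = refl
⌊swap₂/2⌋ 3                         = refl
⌊swap₂/2⌋ (suc (suc (suc (suc n)))) = cong (2 +_) (⌊swap₂/2⌋ n)

⊕2≡swap₂ : ∀ n → n ⊕ 2 ≡ swap₂ n
⊕2≡swap₂ n = bit-ext
  (trans (parity-⊕ n 2) (trans (ℙ.+-identityʳ (parity n)) (sym (parity-swap₂ n))))
  (trans (⌊⊕/2⌋ n 2) (trans (⊕1≡swap ⌊ n /2⌋) (sym (⌊swap₂/2⌋ n))))

-- Comparison of `Φ 7` with the 2-shifted sum

suc-⊕2 : ∀ {u} → 3 ≤ u → suc u ⊕ 2 ≡ suc (ψ 3 u)
suc-⊕2 (s≤s (s≤s (s≤s {n = n} _))) = ⊕2≡swap₂ (4 + n)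

-- The last digit of 5 flips the parity, as the odd `c = 7` does. On halves, the shift by 2 becomes
-- a shift by 1 and 5 becomes 2, which is `ψ 3`.
⊕5≡Φ : ∀ {x} → 30 ≤ x → (x + 2) ⊕ 5 ≡ Φ 7 x + 2
⊕5≡Φ {x} 30≤x = begin
  (x + 2) ⊕ 5                                  ≡⟨ cong (_⊕ 5) (+-comm x 2) ⟩
  (2 + x) ⊕ 5                                  ≡⟨ ⊕-bit (2 + x) 5 ⟩
  bit (parity x +ℙ 1ℙ) (suc ⌊ x /2⌋ ⊕ 2)       ≡⟨ cong (bit (parity x +ℙ 1ℙ)) (suc-⊕2 3≤u) ⟩
  2 + bit (parity x +ℙ 1ℙ) (ψ 3 ⌊ x /2⌋)       ≡⟨ cong (2 +_) (Φ-formula 7 30≤x) ⟨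
  2 + Φ 7 x                                    ≡⟨ +-comm 2 (Φ 7 x) ⟩
  Φ 7 x + 2                                    ∎
  where
  open ≡-Reasoning
  3≤u : 3 ≤ ⌊ x /2⌋
  3≤u = ≤-trans (m≤m+n 3 12) (⌊n/2⌋-mono 30≤x)

φ₇≡Φ-<30 : ∀ {x} → x < 30 → φ₇ x ≡ Φ 7 x
φ₇≡Φ-<30 = from-yes (allUpTo? (λ x → φ₇ x ≟ Φ 7 x) 30)

φ₇-≥30 : ∀ {x} → 30 ≤ x → φ₇ x ≡ x ⊕[ 2 ] 5
φ₇-≥30 {x} 30≤x with x <? 30
... | yes x<30 = contradiction 30≤x (<⇒≱ x<30)
... | no  _    = refl

φ₇≡Φ : ∀ x → φ₇ x ≡ Φ 7 x
φ₇≡Φ x = [ φ₇≡Φ-<30 , φ₇≡Φ-≥30 ]′ (<-≤-connex x 30)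
  where
  φ₇≡Φ-≥30 : 30 ≤ x → φ₇ x ≡ Φ 7 x
  φ₇≡Φ-≥30 30≤x = trans (φ₇-≥30 30≤x)
    (trans (cong (_∸ 2) (⊕5≡Φ 30≤x)) (m+n∸n≡m (Φ 7 x) 2))

theorem32 : (∀ (a b : ℕ) → IsP (a ∷ b ∷ 7 ∷ []) ⇔ b ≡ φ₇ a)
    × (∀ (a b : ℕ) → a ≥ 30 → b ≥ 30 →
    IsP (a ∷ b ∷ 7 ∷ []) ⇔ (a + 2) ⊕ (b + 2) ≡ 5)
theorem32 = everywhere , large
  where
  7<8 : 7 < 8
  7<8 = ≤-refl

  everywhere : ∀ (a b : ℕ) → IsP (a ∷ b ∷ 7 ∷ []) ⇔ b ≡ φ₇ a
  everywhere a b = mk⇔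
    (λ p → sym (trans (φ₇≡Φ a) (Equivalence.to (IsP⇔Φ 7<8) p)))
    (λ eq → Equivalence.from (IsP⇔Φ 7<8) (sym (trans eq (φ₇≡Φ a))))

  large : ∀ (a b : ℕ) → a ≥ 30 → b ≥ 30 → IsP (a ∷ b ∷ 7 ∷ []) ⇔ (a + 2) ⊕ (b + 2) ≡ 5
  large a b 30≤a _ = mk⇔
    -- On the graph `b + 2` is `(a + 2) ⊕ 5`, so a second XOR with `a + 2` leaves 5.
    (λ p → trans (cong ((a + 2) ⊕_) (sym (trans (⊕5≡Φ 30≤a) (cong (_+ 2) (Equivalence.to (IsP⇔Φ 7<8) p)))))
      (⊕-cancel (a + 2) 5))
    (λ eq → Equivalence.from (IsP⇔Φ 7<8) (+-cancelʳ-≡ 2 _ _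
      (trans (sym (⊕5≡Φ 30≤a)) (trans (cong ((a + 2) ⊕_) (sym eq)) (⊕-cancel (a + 2) (b + 2))))))
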